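{- Let $T$ be a complete NIP theory with monster model $\mathcal U$. Let $A\subseteq B\subseteq\mathcal U$ be small sets and $a$ a (possibly infinite, small) tuple from $\mathcal U$. If $\mathrm{tp}(a/B)$ is compressible, then $\mathrm{tp}(a/A)$ is compressible up to $B$.
   Context: $T$ is a complete theory in a language $\mathcal L$, $\mathcal U$ a large saturated model; small means of cardinality $<|\mathcal U|$; $\vdash$ is implication in $\mathcal U$. $T$ is NIP if for every $\mathcal L$-formula $\phi(x,y)$ the family $\{\phi(\mathcal U^x,b):b\in\mathcal U^y\}$ has finite VC-dimension. A type $p(x)=\mathrm{tp}(a/B)$ is compressible if for every $\mathcal L$-formula $\phi(x,y)$ there is an $\mathcal L$-formula $\psi(x,z)$ such that for every finite $B_0\subseteq B$ there is $c\in B^z$ with $\mathcal U\vDash\psi(a,c)$ and $\psi(x,c)\vdash\{\phi(x,b):b\in B_0^y,\ \vDash\phi(a,b)\}\cup\{\neg\phi(x,b):b\in B_0^y,\ \vDash\neg\phi(a,b)\}$. $\mathrm{tp}(a/A)$ is compressible up to $B$ if it is compressible when computed in $\mathcal U_B$, the expansion of $\mathcal U$ by constants for the elements of $B$. Explicitly: for every $\mathcal L(B)$-formula $\phi(x,y)$ there is an $\mathcal L(B)$-formula $\psi(x,z)$ such that for every finite $A_0\subseteq A$ there is $c\in A^z$ with $\vDash\psi(a,c)$ and $\psi(x,c)\vdash\{\phi(x,b):b\in A_0^y,\ \vDash\phi(a,b)\}\cup\{\neg\phi(x,b):b\in A_0^y,\ \vDash\neg\phi(a,b)\}$. -}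

module Defs where

open import Level using (Level; _⊔_) renaming (suc to lsuc)
open import Data.Empty.Polymorphic using (⊥)
open import Data.Fin using (Fin)
open import Data.Fin.Subset using (Subset) renaming (_∈_ to _∈ˢ_)
open import Data.List using (List)
open import Data.List.Membership.Propositional renaming (_∈_ to _∈ˡ_) using ()
import Data.List.Relation.Unary.All as List
open import Data.Maybe using (Maybe; maybe′)
open import Data.Nat using (ℕ; zero; _≤_)
open import Data.Product using (∃; ∃-syntax; Σ-syntax; _×_; proj₁)
open import Data.Sum using (_⊎_; [_,_])
open import Data.Vec using (Vec; []; _∷_; lookup)
import Data.Vec.Relation.Unary.All as Vec
open import Function.Bundles using (_⇔_; _↣_; Injection)
open import Function.Definitions using (Injective)
open import Relation.Binary.PropositionalEquality using (_≡_)
open import Relation.Nullary using (¬_)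
open import Relation.Unary using (Pred; _∈_)

------------------------------------------------------------------------
-- First-order logic

record Language (ℓ : Level) : Set (lsuc ℓ) where
  field
    Func : ℕ → Set ℓ
    Rel  : ℕ → Set ℓ

open Language public

-- V is the set of free variables; it may be infinite, although each
-- formula mentions only finitely many of them.

data Term {ℓ v : Level} (ℒ : Language ℓ) (V : Set v) : Set (ℓ ⊔ v) where
  var : V → Term ℒ V
  app : ∀ {n} → Func ℒ n → Vec (Term ℒ V) n → Term ℒ V

infixr 6 _⇒_
infix  7 _≐_
infix  8 ¬′_

-- In `all φ` the bound variable is `nothing`.  The other connectives are
-- classically definable from these.

data Formula {ℓ v : Level} (ℒ : Language ℓ) (V : Set v) : Set (ℓ ⊔ v) where
  ⊥′  : Formula ℒ V
  _≐_ : Term ℒ V → Term ℒ V → Formula ℒ V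
  rel : ∀ {n} → Rel ℒ n → Vec (Term ℒ V) n → Formula ℒ V
  _⇒_ : Formula ℒ V → Formula ℒ V → Formula ℒ V
  all : Formula ℒ (Maybe V) → Formula ℒ V

¬′_ : ∀ {ℓ v} {ℒ : Language ℓ} {V : Set v} → Formula ℒ V → Formula ℒ V
¬′ φ = φ ⇒ ⊥′

Sentence : ∀ {ℓ} → Language ℓ → Set ℓ
Sentence ℒ = Formula ℒ (Fin 0)

record Structure {ℓ : Level} (ℒ : Language ℓ) : Set (lsuc ℓ) where
  field
    Carrier  : Set ℓ
    nonempty : Carrier
    ⟦_⟧ᶠ     : ∀ {n} → Func ℒ n → Vec Carrier n → Carrier
    ⟦_⟧ʳ     : ∀ {n} → Rel ℒ n → Pred (Vec Carrier n) ℓ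

open Structure public

module _ {ℓ v : Level} {ℒ : Language ℓ} {V : Set v} (M : Structure ℒ) where

  mutual
    eval : (V → Carrier M) → Term ℒ V → Carrier M
    eval ρ (var x)    = ρ x
    eval ρ (app f ts) = ⟦ M ⟧ᶠ f (evals ρ ts)

    evals : (V → Carrier M) → ∀ {n} → Vec (Term ℒ V) n → Vec (Carrier M) n
    evals ρ []       = []
    evals ρ (t ∷ ts) = eval ρ t ∷ evals ρ ts

infix 4 _⊨_[_]

_⊨_[_] : ∀ {ℓ v} {ℒ : Language ℓ} {V : Set v} (M : Structure ℒ) →
         Formula ℒ V → (V → Carrier M) → Set ℓ
M ⊨ ⊥′       [ ρ ] = ⊥
M ⊨ s ≐ t    [ ρ ] = eval M ρ s ≡ eval M ρ t
M ⊨ rel R ts [ ρ ] = ⟦ M ⟧ʳ R (evals M ρ ts)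
M ⊨ φ ⇒ χ    [ ρ ] = M ⊨ φ [ ρ ] → M ⊨ χ [ ρ ]
M ⊨ all φ    [ ρ ] = ∀ u → M ⊨ φ [ maybe′ ρ u ]

infix 4 _⊨ₛ_

_⊨ₛ_ : ∀ {ℓ} {ℒ : Language ℓ} → Structure ℒ → Sentence ℒ → Set ℓ
M ⊨ₛ σ = M ⊨ σ [ (λ ()) ]

-- φ(a, b) for a formula φ(x, y), where x is indexed by I and y is a
-- finite tuple of variables.

infix 4 _⊨_⟨_,_⟩

_⊨_⟨_,_⟩ : ∀ {ℓ i n} {ℒ : Language ℓ} {I : Set i} (M : Structure ℒ) →
           Formula ℒ (I ⊎ Fin n) → (I → Carrier M) → Vec (Carrier M) n → Set ℓ
M ⊨ φ ⟨ a , b ⟩ = M ⊨ φ [ [ a , lookup b ] ]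

------------------------------------------------------------------------
-- Expansion by constants for the elements of a set

data FuncWith {ℓ : Level} (ℒ : Language ℓ) (C : Set ℓ) : ℕ → Set ℓ where
  old   : ∀ {n} → Func ℒ n → FuncWith ℒ C n
  const : C → FuncWith ℒ C zero

_⊕_ : ∀ {ℓ} → Language ℓ → Set ℓ → Language ℓ
ℒ ⊕ C = record { Func = FuncWith ℒ C ; Rel = Rel ℒ }

_⟪_⟫ : ∀ {ℓ} {ℒ : Language ℓ} (M : Structure ℒ) (B : Pred (Carrier M) ℓ) →
       Structure (ℒ ⊕ ∃ B)
M ⟪ B ⟫ = record
  { Carrier  = Carrier M
  ; nonempty = nonempty M
  ; ⟦_⟧ᶠ     = λ { (old f) us → ⟦ M ⟧ᶠ f us ; (const c) _ → proj₁ c }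
  ; ⟦_⟧ʳ     = ⟦ M ⟧ʳ
  }

------------------------------------------------------------------------
-- Theories

Theory : ∀ {ℓ} → Language ℓ → Set (lsuc ℓ)
Theory {ℓ} ℒ = Pred (Sentence ℒ) ℓ

Models : ∀ {ℓ} {ℒ : Language ℓ} → Theory ℒ → Structure ℒ → Set ℓ
Models T M = ∀ σ → σ ∈ T → M ⊨ₛ σ

infix 4 _⊫_

_⊫_ : ∀ {ℓ} {ℒ : Language ℓ} → Theory ℒ → Sentence ℒ → Set (lsuc ℓ)
T ⊫ σ = ∀ M → Models T M → M ⊨ₛ σ

Complete : ∀ {ℓ} {ℒ : Language ℓ} → Theory ℒ → Set (lsuc ℓ)
Complete {ℒ = ℒ} T =
  (Σ[ M ∈ Structure ℒ ] Models T M) × (∀ σ → (T ⊫ σ) ⊎ (T ⊫ ¬′ σ))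

------------------------------------------------------------------------
-- Cardinality and saturation

infix 4 _≺_

-- |X| < |Y|
_≺_ : ∀ {x y} → Set x → Set y → Set (x ⊔ y)
X ≺ Y = (X ↣ Y) × ¬ (Y ↣ X)

-- |A| < |X| for a subset A of X.  As |A| ≤ |X| always holds, this only says
-- that X does not inject into A.  It is not phrased as ∃ A ≺ X because ∃ A
-- has one element for each proof of membership, so it can be larger than A.

SmallSubset : ∀ {ℓ} {X : Set ℓ} → Pred X ℓ → Set ℓ
SmallSubset {X = X} A = ¬ (Σ[ f ∈ (X ↣ X) ] (∀ x → Injection.to f x ∈ A))

-- Every set of formulas in one variable over a small A that is finitely
-- satisfiable in M is realised in M.

Saturated : ∀ {ℓ} {ℒ : Language ℓ} → Structure ℒ → Set (lsuc ℓ)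
Saturated {ℓ} {ℒ} M =
  (A : Pred (Carrier M) ℓ) → SmallSubset A →
  (p : Pred (Formula (ℒ ⊕ ∃ A) (Fin 1)) ℓ) →
  (∀ φs → List.All p φs →
    ∃[ u ] List.All (λ φ → M ⟪ A ⟫ ⊨ φ [ (λ _ → u) ]) φs) →
  ∃[ u ] (∀ φ → φ ∈ p → M ⟪ A ⟫ ⊨ φ [ (λ _ → u) ])

-- There are |ℒ| + ℵ₀ many formulas with variables from ℕ.

record Monster {ℓ : Level} {ℒ : Language ℓ}
               (T : Theory ℒ) (𝒰 : Structure ℒ) : Set (lsuc ℓ) where
  field
    models    : Models T 𝒰
    saturated : Saturated 𝒰
    large     : Formula ℒ ℕ ≺ Carrier 𝒰

------------------------------------------------------------------------
-- NIP

Shatters : ∀ {j x ℓ k} {J : Set j} {X : Set x} →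
           (J → Pred X ℓ) → (Fin k → X) → Set (j ⊔ ℓ)
Shatters {k = k} F pts =
  (s : Subset k) → ∃[ j ] (∀ i → (i ∈ˢ s) ⇔ (pts i ∈ F j))

FiniteVCDimension : ∀ {j x ℓ} {J : Set j} {X : Set x} →
                    (J → Pred X ℓ) → Set (j ⊔ x ⊔ ℓ)
FiniteVCDimension {X = X} F =
  ∃[ d ] (∀ k (pts : Fin k → X) → Injective _≡_ _≡_ pts →
          Shatters F pts → k ≤ d)

-- Being NIP is a property of a complete theory, tested in its monster model.

NIP : ∀ {ℓ} {ℒ : Language ℓ} → Structure ℒ → Set ℓ
NIP {ℒ = ℒ} 𝒰 =
  ∀ {m n} (φ : Formula ℒ (Fin m ⊎ Fin n)) →
  FiniteVCDimension {J = Vec (Carrier 𝒰) n} {X = Vec (Carrier 𝒰) m}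
    (λ b a → 𝒰 ⊨ φ ⟨ lookup a , b ⟩)

------------------------------------------------------------------------
-- Compressible types

-- tp(a/B) is compressible.  The universally quantified a′ expresses ⊢,
-- implication in 𝒰.

Compressible : ∀ {ℓ i} {ℒ : Language ℓ} {I : Set i} (𝒰 : Structure ℒ) →
               (I → Carrier 𝒰) → Pred (Carrier 𝒰) ℓ → Set (ℓ ⊔ i)
Compressible {ℒ = ℒ} {I = I} 𝒰 a B =
  ∀ {n} (φ : Formula ℒ (I ⊎ Fin n)) →
  ∃[ m ] Σ[ ψ ∈ Formula ℒ (I ⊎ Fin m) ]
    ((B₀ : List (Carrier 𝒰)) → List.All B B₀ →
     Σ[ c ∈ Vec (Carrier 𝒰) m ]
       ( Vec.All B c
       × (𝒰 ⊨ ψ ⟨ a , c ⟩)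
       × (∀ a′ → 𝒰 ⊨ ψ ⟨ a′ , c ⟩ →
          ∀ b → Vec.All (_∈ˡ B₀) b →
            (𝒰 ⊨ φ ⟨ a , b ⟩ → 𝒰 ⊨ φ ⟨ a′ , b ⟩)
          × (𝒰 ⊨ ¬′ φ ⟨ a , b ⟩ → 𝒰 ⊨ ¬′ φ ⟨ a′ , b ⟩))))

-- tp(a/A) is compressible up to B.

CompressibleUpTo : ∀ {ℓ i} {ℒ : Language ℓ} {I : Set i} (𝒰 : Structure ℒ) →
                   (I → Carrier 𝒰) → (A B : Pred (Carrier 𝒰) ℓ) → Set (ℓ ⊔ i)
CompressibleUpTo 𝒰 a A B = Compressible (𝒰 ⟪ B ⟫) a A

{-# OPTIONS --safe #-}

-- With the elements of B named by constants, suppose that no formula ψ(x,c)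
-- with c in A implies φ(x,b) for all b from a given finite subset of A with
-- ⊨ φ(a,b).  Let ψ₀ compress φ over B, and say that w decides b if
-- ψ₀(x,w) ⊢ φ(x,b).  For every N there are N tuples from A shattered by the
-- sets { b | w decides b }, so that the formula "w decides b" has IP.
--
-- The witnesses w are chosen such that ψ(x,D) ⊢ ψ₀(x,w) for a single D from B
-- with ⊨ ψ(a,D), and such that they decide any finite set prescribed in
-- advance.  To go from N to N + 1, take a finite L ⊆ A such that, whatever is
-- known about a over A, some φ(x,b) with b ∈ L remains undecided, and then a
-- family e of size N with witnesses, below some D, that decide L.  Let ψ′
-- compress ψ.  If no family b, e can be used for N + 1, then for D′ from B
-- above D the witnesses below D′ that do not decide b fail to shatter e.  But
-- undecidedness lets us move a to some x with ¬ φ(x,b), and above a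
-- correspondingly moved D they do shatter e.  Iterating, one can move or not
-- move independently at any number of pairs b, e, so that the failure to
-- shatter has IP.

module Submission where

open import Defs
open import Axiom.ExcludedMiddle using (ExcludedMiddle)
open import Axiom.Extensionality.Propositional using (Extensionality)
open import Data.Bool using (true; false)
open import Data.Empty using (⊥)
import Data.Empty.Polymorphic as Empty
open import Data.Fin using (Fin; zero; suc; _↑ˡ_; _↑ʳ_)
open import Data.Fin.Properties using (*↔×; +↔⊎)
open import Data.Fin.Subset using (Subset; inside; outside; ⁅_⁆) renaming (_∈_ to _∈ˢ_)
open import Data.Fin.Subset.Properties using (x∈⁅x⁆; x∈⁅y⁆⇒x≡y; drop-there)
open import Data.List using (List; []; _∷_; _++_; allFin; cartesianProductWith; concatMap; filter; mapMaybe)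
import Data.List as L
open import Data.List.Membership.Propositional using (lose) renaming (_∈_ to _∈ˡ_)
open import Data.List.Membership.Propositional.Properties
  using (∈-allFin; ∈-++⁺ˡ; ∈-++⁺ʳ; ∈-filter⁺; ∈-cartesianProductWith⁺; ∈-concatMap⁺; ∈-tabulate⁺)
open import Data.List.Relation.Unary.All as All using (All; []; _∷_)
import Data.List.Relation.Unary.All.Properties as All
open import Data.List.Relation.Unary.Any using (here; there; index)
open import Data.List.Relation.Unary.Any.Properties using (lookup-index)
open import Data.Maybe using (Maybe; just; nothing; maybe′)
import Data.Maybe as Maybe
open import Data.Nat using (ℕ; zero; suc; _+_; _≤_)
open import Data.Nat.Properties using (1+n≰n)
open import Data.Product using (∃; ∃-syntax; Σ-syntax; _×_; _,_; proj₁; proj₂; uncurry; curry)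
open import Data.Product.Function.NonDependent.Propositional using (_×-↔_)
open import Data.Sum using (_⊎_; inj₁; inj₂; [_,_]; isInj₂)
open import Data.Sum.Function.Propositional using (_⊎-↔_)
open import Data.Unit using (tt)
open import Data.Unit.Polymorphic using (⊤)
import Data.Vec as Vec
open import Data.Vec using (Vec; []; _∷_; here; there; lookup; tabulate)
open import Data.Vec.Functional using () renaming (_∷_ to _∷ᶠ_)
open import Data.Vec.Membership.Propositional.Properties using (∈-lookup; ∈-toList⁺)
open import Data.Vec.Properties using (lookup∘tabulate; tabulate∘lookup; lookup-++ˡ; lookup-++ʳ)
import Data.Vec.Relation.Unary.All as Allᵛ
import Data.Vec.Relation.Unary.All.Properties as Allᵛₚ
open import Function using (_∘_; id)
open import Function.Bundles using (_⇔_; mk⇔; Equivalence; _↔_; Inverse)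
open import Function.Construct.Composition using (_↔-∘_)
import Function.Properties.Equivalence as ⇔
open import Function.Properties.Inverse using (↔-refl)
open import Level using (Level; _⊔_) renaming (suc to lsuc)
open import Relation.Binary.PropositionalEquality
  using (_≡_; refl; sym; trans; cong; cong₂; subst) renaming (setoid to ≡-setoid)
open import Relation.Nullary using (¬_; Dec; yes; no; contradiction)
open import Relation.Nullary.Decidable using (decidable-stable)
open import Relation.Unary using (Pred; _⊆_)

open Equivalence using (to; from)

private variable
  ℓ v w p q : Level
  ℒ : Language ℓ
  V : Set v
  W : Set w
  n : ℕ

suc∈⇔ : ∀ {i b} {s : Subset n} → (suc i ∈ˢ b ∷ s) ⇔ (i ∈ˢ s)
suc∈⇔ = mk⇔ drop-there there

-- Syntax: renaming, free variables and constants

module _ {ℒ : Language ℓ} where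

  mutual
    renameᵗ : (V → W) → Term ℒ V → Term ℒ W
    renameᵗ f (var x)    = var (f x)
    renameᵗ f (app g ts) = app g (renameᵗˢ f ts)

    renameᵗˢ : (V → W) → Vec (Term ℒ V) n → Vec (Term ℒ W) n
    renameᵗˢ f []       = []
    renameᵗˢ f (t ∷ ts) = renameᵗ f t ∷ renameᵗˢ f ts

  rename : (V → W) → Formula ℒ V → Formula ℒ W
  rename f ⊥′         = ⊥′
  rename f (s ≐ t)    = renameᵗ f s ≐ renameᵗ f t
  rename f (rel R ts) = rel R (renameᵗˢ f ts)
  rename f (φ ⇒ χ)    = rename f φ ⇒ rename f χ
  rename f (all φ)    = all (rename (Maybe.map f) φ)

  mutual
    varsᵗ : Term ℒ V → List V
    varsᵗ (var x)    = x ∷ []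
    varsᵗ (app g ts) = varsᵗˢ ts

    varsᵗˢ : Vec (Term ℒ V) n → List V
    varsᵗˢ []       = []
    varsᵗˢ (t ∷ ts) = varsᵗ t ++ varsᵗˢ ts

  vars : Formula ℒ V → List V
  vars ⊥′         = []
  vars (s ≐ t)    = varsᵗ s ++ varsᵗ t
  vars (rel R ts) = varsᵗˢ ts
  vars (φ ⇒ χ)    = vars φ ++ vars χ
  vars (all φ)    = mapMaybe id (vars φ)

module _ {ℒ : Language ℓ} {C : Set ℓ} where

  mutual
    embedᵗ : Term ℒ V → Term (ℒ ⊕ C) V
    embedᵗ (var x)    = var x
    embedᵗ (app g ts) = app (old g) (embedᵗˢ ts)

    embedᵗˢ : Vec (Term ℒ V) n → Vec (Term (ℒ ⊕ C) V) n
    embedᵗˢ []       = []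
    embedᵗˢ (t ∷ ts) = embedᵗ t ∷ embedᵗˢ ts

  embed : Formula ℒ V → Formula (ℒ ⊕ C) V
  embed ⊥′         = ⊥′
  embed (s ≐ t)    = embedᵗ s ≐ embedᵗ t
  embed (rel R ts) = rel R (embedᵗˢ ts)
  embed (φ ⇒ χ)    = embed φ ⇒ embed χ
  embed (all φ)    = all (embed φ)

  mutual
    abstractᵗ : Term (ℒ ⊕ C) V → Term ℒ (V ⊎ C)
    abstractᵗ (var x)            = var (inj₁ x)
    abstractᵗ (app (old g) ts)   = app g (abstractᵗˢ ts)
    abstractᵗ (app (const c) ts) = var (inj₂ c)

    abstractᵗˢ : Vec (Term (ℒ ⊕ C) V) n → Vec (Term ℒ (V ⊎ C)) n
    abstractᵗˢ []       = []
    abstractᵗˢ (t ∷ ts) = abstractᵗ t ∷ abstractᵗˢ ts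

  -- A constant c becomes the variable inj₂ c.
  abstractConsts : Formula (ℒ ⊕ C) V → Formula ℒ (V ⊎ C)
  abstractConsts ⊥′         = ⊥′
  abstractConsts (s ≐ t)    = abstractᵗ s ≐ abstractᵗ t
  abstractConsts (rel R ts) = rel R (abstractᵗˢ ts)
  abstractConsts (φ ⇒ χ)    = abstractConsts φ ⇒ abstractConsts χ
  abstractConsts (all φ)    =
    all (rename [ Maybe.map inj₁ , just ∘ inj₂ ] (abstractConsts φ))

module Classical (em : ∀ {o} → ExcludedMiddle o)
                 (ext : ∀ {o p} → Extensionality o p) where

  byContradiction : {P : Set p} → ¬ ¬ P → P
  byContradiction = decidable-stable em

  -- Truth under renaming and under change of assignment

  module _ (M : Structure ℒ) where

    mutual
      eval-rename : ∀ (f : V → W) ρ t → eval M ρ (renameᵗ f t) ≡ eval M (ρ ∘ f) t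
      eval-rename f ρ (var x)    = refl
      eval-rename f ρ (app g ts) = cong (⟦ M ⟧ᶠ g) (evals-rename f ρ ts)

      evals-rename : ∀ (f : V → W) ρ (ts : Vec (Term _ V) n) →
                     evals M ρ (renameᵗˢ f ts) ≡ evals M (ρ ∘ f) ts
      evals-rename f ρ []       = refl
      evals-rename f ρ (t ∷ ts) = cong₂ _∷_ (eval-rename f ρ t) (evals-rename f ρ ts)

    -- An equality of types rather than an equivalence, so that each connective is handled by
    -- congruence, with function extensionality under `all`.
    ⊨-rename : ∀ (f : V → W) φ ρ → (M ⊨ rename f φ [ ρ ]) ≡ (M ⊨ φ [ ρ ∘ f ])
    ⊨-rename f ⊥′         ρ = refl
    ⊨-rename f (s ≐ t)    ρ = cong₂ _≡_ (eval-rename f ρ s) (eval-rename f ρ t)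
    ⊨-rename f (rel R ts) ρ = cong (⟦ M ⟧ʳ R) (evals-rename f ρ ts)
    ⊨-rename f (φ ⇒ χ)    ρ = cong₂ (λ X Y → X → Y) (⊨-rename f φ ρ) (⊨-rename f χ ρ)
    ⊨-rename f (all φ)    ρ = cong (λ P → ∀ u → P u) (ext λ u →
      trans (⊨-rename (Maybe.map f) φ (maybe′ ρ u))
            (cong (M ⊨ φ [_]) (ext λ { nothing → refl ; (just x) → refl })))

    Agree : (V → Carrier M) → (V → Carrier M) → V → Set _
    Agree ρ ρ′ x = ρ x ≡ ρ′ x

    mutual
      eval-agree : ∀ {ρ ρ′ : V → Carrier M} t → All (Agree ρ ρ′) (varsᵗ t) →
                   eval M ρ t ≡ eval M ρ′ t
      eval-agree (var x)    (eq ∷ []) = eq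
      eval-agree (app g ts) eqs       = cong (⟦ M ⟧ᶠ g) (evals-agree ts eqs)

      evals-agree : ∀ {ρ ρ′ : V → Carrier M} (ts : Vec (Term _ V) n) →
                    All (Agree ρ ρ′) (varsᵗˢ ts) → evals M ρ ts ≡ evals M ρ′ ts
      evals-agree []       eqs = refl
      evals-agree (t ∷ ts) eqs =
        cong₂ _∷_ (eval-agree t (All.++⁻ˡ (varsᵗ t) eqs))
                  (evals-agree ts (All.++⁻ʳ (varsᵗ t) eqs))

    Agree-maybe : ∀ {ρ ρ′ : V → Carrier M} u xs → All (Agree ρ ρ′) (mapMaybe id xs) →
                  All (Agree (maybe′ ρ u) (maybe′ ρ′ u)) xs
    Agree-maybe u []             eqs        = []
    Agree-maybe u (nothing ∷ xs) eqs        = refl ∷ Agree-maybe u xs eqs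
    Agree-maybe u (just x ∷ xs)  (eq ∷ eqs) = eq ∷ Agree-maybe u xs eqs

    ⊨-agree : ∀ φ {ρ ρ′ : V → Carrier M} → All (Agree ρ ρ′) (vars φ) →
              (M ⊨ φ [ ρ ]) ≡ (M ⊨ φ [ ρ′ ])
    ⊨-agree ⊥′         eqs = refl
    ⊨-agree (s ≐ t)    eqs = cong₂ _≡_ (eval-agree s (All.++⁻ˡ (varsᵗ s) eqs))
                                       (eval-agree t (All.++⁻ʳ (varsᵗ s) eqs))
    ⊨-agree (rel R ts) eqs = cong (⟦ M ⟧ʳ R) (evals-agree ts eqs)
    ⊨-agree (φ ⇒ χ)    eqs = cong₂ (λ X Y → X → Y) (⊨-agree φ (All.++⁻ˡ (vars φ) eqs))
                                                   (⊨-agree χ (All.++⁻ʳ (vars φ) eqs))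
    ⊨-agree (all φ)    eqs = cong (λ P → ∀ u → P u)
      (ext λ u → ⊨-agree φ (Agree-maybe u (vars φ) eqs))

  -- Truth in the expansion by constants

  module _ {ℒ : Language ℓ} (M : Structure ℒ) (B : Pred (Carrier M) ℓ) where

    mutual
      eval-embed : ∀ {ρ : V → Carrier M} t →
                   eval (M ⟪ B ⟫) ρ (embedᵗ t) ≡ eval M ρ t
      eval-embed (var x)    = refl
      eval-embed (app g ts) = cong (⟦ M ⟧ᶠ g) (evals-embed ts)

      evals-embed : ∀ {ρ : V → Carrier M} (ts : Vec (Term ℒ V) n) →
                    evals (M ⟪ B ⟫) ρ (embedᵗˢ ts) ≡ evals M ρ ts
      evals-embed []       = refl
      evals-embed (t ∷ ts) = cong₂ _∷_ (eval-embed t) (evals-embed ts)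

    ⊨-embed : ∀ φ {ρ : V → Carrier M} → (M ⟪ B ⟫ ⊨ embed φ [ ρ ]) ≡ (M ⊨ φ [ ρ ])
    ⊨-embed ⊥′         = refl
    ⊨-embed (s ≐ t)    = cong₂ _≡_ (eval-embed s) (eval-embed t)
    ⊨-embed (rel R ts) = cong (⟦ M ⟧ʳ R) (evals-embed ts)
    ⊨-embed (φ ⇒ χ)    = cong₂ (λ X Y → X → Y) (⊨-embed φ) (⊨-embed χ)
    ⊨-embed (all φ)    = cong (λ P → ∀ u → P u) (ext λ u → ⊨-embed φ)

    mutual
      eval-abstract : ∀ {ρ : V → Carrier M} t →
                      eval M [ ρ , proj₁ ] (abstractᵗ t) ≡ eval (M ⟪ B ⟫) ρ t
      eval-abstract (var x)            = refl
      eval-abstract (app (old g) ts)   = cong (⟦ M ⟧ᶠ g) (evals-abstract ts)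
      eval-abstract (app (const c) ts) = refl

      evals-abstract : ∀ {ρ : V → Carrier M} (ts : Vec (Term (ℒ ⊕ ∃ B) V) n) →
                       evals M [ ρ , proj₁ ] (abstractᵗˢ ts) ≡ evals (M ⟪ B ⟫) ρ ts
      evals-abstract []       = refl
      evals-abstract (t ∷ ts) = cong₂ _∷_ (eval-abstract t) (evals-abstract ts)

    ⊨-abstract : ∀ φ {ρ : V → Carrier M} →
                 (M ⊨ abstractConsts φ [ [ ρ , proj₁ ] ]) ≡ (M ⟪ B ⟫ ⊨ φ [ ρ ])
    ⊨-abstract ⊥′         = refl
    ⊨-abstract (s ≐ t)    = cong₂ _≡_ (eval-abstract s) (eval-abstract t)
    ⊨-abstract (rel R ts) = cong (⟦ M ⟧ʳ R) (evals-abstract ts)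
    ⊨-abstract (φ ⇒ χ)    = cong₂ (λ X Y → X → Y) (⊨-abstract φ) (⊨-abstract χ)
    ⊨-abstract (all φ)    = cong (λ P → ∀ u → P u) (ext λ u →
      trans (⊨-rename M _ (abstractConsts φ) _)
        (trans (cong (M ⊨ abstractConsts φ [_])
                     (ext λ { (inj₁ nothing) → refl ; (inj₁ (just x)) → refl ; (inj₂ c) → refl }))
               (⊨-abstract φ)))

  -- Definable predicates

  module Definability {ℒ : Language ℓ} (M : Structure ℒ) where

    private
      U = Carrier M
      variable J : Set v

    -- Complex conditions are stated as predicates and shown definable by closure properties, so
    -- that no large formula has to be written with its bound variables.
    record Definable {v p} {V : Set v} (P : (V → U) → Set p) : Set (ℓ ⊔ v ⊔ p) where
      constructor _by_
      field
        formula : Formula ℒ V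
        defines : ∀ ρ → (M ⊨ formula [ ρ ]) ⇔ P ρ

    open Definable public

    ⊨-definable : (φ : Formula ℒ V) → Definable (M ⊨ φ [_])
    ⊨-definable φ = φ by λ ρ → ⇔.refl

    resp : {P : (V → U) → Set p} {Q : (V → U) → Set q} →
           (∀ ρ → P ρ ⇔ Q ρ) → Definable P → Definable Q
    resp P⇔Q (φ by d) = φ by λ ρ → ⇔.trans (d ρ) (P⇔Q ρ)

    pullback : {P : (V → U) → Set p} (f : V → W) → Definable P → Definable (λ ρ → P (ρ ∘ f))
    pullback f (φ by d) = rename f φ by λ ρ →
      subst (_⇔ _) (sym (⊨-rename M f φ ρ)) (d (ρ ∘ f))

    ⊤-definable : {X : Set p} → X → Definable {V = V} (λ _ → X)
    ⊤-definable x = (⊥′ ⇒ ⊥′) by λ ρ → mk⇔ (λ _ → x) (λ _ z → z)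

    -- Excluded middle picks truth or falsity as the formula. In this way side conditions such as
    -- `i ∈ˢ s` enter definable predicates.
    fixed-definable : (X : Set p) → Definable {V = V} (λ _ → X)
    fixed-definable X with em {P = X}
    ... | yes x = ⊤-definable x
    ... | no ¬x = ⊥′ by λ ρ → mk⇔ Empty.⊥-elim (λ x → contradiction x ¬x)

    infixr 4 _→-definable_
    infixr 5 _×-definable_

    _→-definable_ : {P : (V → U) → Set p} {Q : (V → U) → Set q} →
                    Definable P → Definable Q → Definable (λ ρ → P ρ → Q ρ)
    (φ by d) →-definable (χ by e) = (φ ⇒ χ) by λ ρ →
      mk⇔ (λ f x → to (e ρ) (f (from (d ρ) x))) (λ f x → from (e ρ) (f (to (d ρ) x)))

    ¬-definable : {P : (V → U) → Set p} → Definable P → Definable (λ ρ → ¬ P ρ)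
    ¬-definable (φ by d) = (¬′ φ) by λ ρ →
      mk⇔ (λ f x → Empty.⊥-elim (f (from (d ρ) x))) (λ f x → contradiction (to (d ρ) x) f)

    _×-definable_ : {P : (V → U) → Set p} {Q : (V → U) → Set q} →
                    Definable P → Definable Q → Definable (λ ρ → P ρ × Q ρ)
    P ×-definable Q = resp
      (λ ρ → mk⇔ (λ f → byContradiction λ g → f (λ x y → g (x , y))) (λ (x , y) f → f x y))
      (¬-definable (P →-definable ¬-definable Q))

    ⇔-definable : {P : (V → U) → Set p} {Q : (V → U) → Set q} →
                  Definable P → Definable Q → Definable (λ ρ → P ρ ⇔ Q ρ)
    ⇔-definable P Q = resp
      (λ ρ → mk⇔ (λ (f , g) → mk⇔ f g) (λ e → to e , from e))
      ((P →-definable Q) ×-definable (Q →-definable P))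

    All-definable : {X : Set w} {P : X → (V → U) → Set p} {xs : List X} →
                    All (λ x → Definable (P x)) xs → Definable (λ ρ → All (λ x → P x ρ) xs)
    All-definable []       = resp (λ ρ → mk⇔ (λ _ → []) (λ _ → tt)) (⊤-definable tt)
    All-definable (d ∷ ds) = resp
      (λ ρ → mk⇔ (λ (px , pxs) → px ∷ pxs) (λ { (px ∷ pxs) → px , pxs }))
      (d ×-definable All-definable ds)

    ∀Fin-definable : {P : Fin n → (V → U) → Set p} →
                     (∀ i → Definable (P i)) → Definable (λ ρ → ∀ i → P i ρ)
    ∀Fin-definable {n = n} P = resp
      (λ ρ → mk⇔ (λ ps i → All.lookup ps (∈-allFin i)) (λ f → All.tabulate λ {i} _ → f i))
      (All-definable (All.universal P (allFin n)))

    ∀Subset-definable : ∀ {n} {P : Subset n → (V → U) → Set p} →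
                        (∀ s → Definable (P s)) → Definable (λ ρ → ∀ s → P s ρ)
    ∀Subset-definable {n = zero}  P = resp (λ ρ → mk⇔ (λ { p [] → p }) (λ f → f [])) (P [])
    ∀Subset-definable {n = suc n} P = resp
      (λ ρ → mk⇔ (λ { (f , g) (true ∷ s) → f s ; (f , g) (false ∷ s) → g s })
                 (λ f → (λ s → f (true ∷ s)) , (λ s → f (false ∷ s))))
      (∀Subset-definable (λ s → P (true ∷ s)) ×-definable ∀Subset-definable (λ s → P (false ∷ s)))

    private
      unless : V → V → Maybe V
      unless x y with em {P = y ≡ x}
      ... | yes _ = nothing
      ... | no  _ = just y

      -- Binding a variable leaves the type `V` unchanged; the variable merely ceases to occur free.
      bind : List V → Formula ℒ V → Formula ℒ V
      bind []       φ = φ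
      bind (x ∷ xs) φ = all (rename (unless x) (bind xs φ))

      unless-agree : ∀ {ρ τ : V → U} {xs} x y → τ y ≡ ρ y ⊎ y ∈ˡ x ∷ xs →
                     τ y ≡ maybe′ ρ (τ x) (unless x y) ⊎ y ∈ˡ xs
      unless-agree x y eq with em {P = y ≡ x}
      unless-agree x y eq               | yes refl = inj₁ refl
      unless-agree x y (inj₁ eq)        | no  _    = inj₁ eq
      unless-agree x y (inj₂ (here eq)) | no  neq  = contradiction eq neq
      unless-agree x y (inj₂ (there i)) | no  _    = inj₂ i

      bind-elim : ∀ xs φ {ρ τ : V → U} → M ⊨ bind xs φ [ ρ ] →
                  All (λ y → τ y ≡ ρ y ⊎ y ∈ˡ xs) (vars φ) → M ⊨ φ [ τ ]
      bind-elim []       φ h eqs =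
        subst id (sym (⊨-agree M φ (All.map (λ { (inj₁ eq) → eq ; (inj₂ ()) }) eqs))) h
      bind-elim (x ∷ xs) φ {ρ} {τ} h eqs =
        bind-elim xs φ (subst id (⊨-rename M (unless x) (bind xs φ) _) (h (τ x)))
          (All.map (λ {y} → unless-agree x y) eqs)

      bind-intro : ∀ js (φ : Formula ℒ (V ⊎ J)) {ρ} →
                   (∀ τ → (∀ x → τ (inj₁ x) ≡ ρ (inj₁ x)) → M ⊨ φ [ τ ]) →
                   M ⊨ bind (L.map inj₂ js) φ [ ρ ]
      bind-intro []       φ {ρ} h   = h ρ λ x → refl
      bind-intro (j ∷ js) φ {ρ} h u =
        subst id (sym (⊨-rename M (unless (inj₂ j)) (bind (L.map inj₂ js) φ) _))
          (bind-intro js φ λ τ eq → h τ λ x → trans (eq x) (kept x))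
        where
        kept : ∀ x → maybe′ ρ u (unless (inj₂ j) (inj₁ x)) ≡ ρ (inj₁ x)
        kept x with em {P = inj₁ x ≡ inj₂ j}
        ... | yes ()
        ... | no _ = refl

      ∈-isInj₂ : ∀ {j} {xs : List (V ⊎ J)} → inj₂ j ∈ˡ xs →
                 _∈ˡ_ {A = V ⊎ J} (inj₂ j) (L.map inj₂ (mapMaybe isInj₂ xs))
      ∈-isInj₂                    (here refl) = here refl
      ∈-isInj₂ {xs = inj₁ x ∷ xs} (there i)   = ∈-isInj₂ i
      ∈-isInj₂ {xs = inj₂ j ∷ xs} (there i)   = there (∈-isInj₂ i)

    -- The tuple x may be infinite: only the variables that occur in the
    -- defining formula have to be quantified.
    ∀-definable : (P : (V → U) → (J → U) → Set p) →
                  Definable (λ τ → P (τ ∘ inj₁) (τ ∘ inj₂)) →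
                  Definable (λ ρ → ∀ x → P ρ x)
    ∀-definable {V = V} {J = J} P (φ by d) = all (rename drop closed) by λ ρ → mk⇔
      (λ h x → to (d [ ρ , x ]) (bind-elim (L.map inj₂ js) φ
        (subst id (⊨-rename M drop closed _) (h (nonempty M)))
        (All.tabulate λ { {inj₁ v} _ → inj₁ refl ; {inj₂ j} i → inj₂ (∈-isInj₂ i) })))
      (λ h u → subst id (sym (⊨-rename M drop closed _)) (bind-intro js φ λ τ eq →
        from (d τ) (subst (λ ρ′ → P ρ′ (τ ∘ inj₂)) (sym (ext eq)) (h _))))
      where
      -- The type of `closed` still has variables `inj₂ j`, none of them free in it. They are sent
      -- to a dummy variable bound by the outer `all`, since `V` may be empty.
      drop : V ⊎ J → Maybe V
      drop = [ just , (λ _ → nothing) ]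
      js = mapMaybe isInj₂ (vars φ)
      closed = bind (L.map inj₂ js) φ

    ∃-definable : (P : (V → U) → (J → U) → Set p) →
                  Definable (λ τ → P (τ ∘ inj₁) (τ ∘ inj₂)) →
                  Definable (λ ρ → ∃[ x ] P ρ x)
    ∃-definable P d = resp
      (λ ρ → mk⇔ (λ f → byContradiction λ g → f λ x px → g (x , px)) (λ (x , px) f → f x px))
      (¬-definable (∀-definable (λ ρ x → ¬ P ρ x) (¬-definable d)))

    finiteSupport : (P : (V → U) → (J → U) → Set p) →
                    Definable (λ τ → P (τ ∘ inj₁) (τ ∘ inj₂)) →
                    ∃[ js ] ∀ ρ {x y} → All (λ j → x j ≡ y j) js → P ρ x → P ρ y
    finiteSupport {V = V} {J = J} P (φ by d) = mapMaybe isInj₂ (vars φ) , λ ρ {x} {y} eqs h →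
      to (d [ ρ , y ]) (subst id (⊨-agree M φ (agree (vars φ) eqs)) (from (d [ ρ , x ]) h))
      where
      agree : ∀ {ρ x y} (vs : List (V ⊎ J)) → All (λ j → x j ≡ y j) (mapMaybe isInj₂ vs) →
              All (Agree M [ ρ , x ] [ ρ , y ]) vs
      agree []            eqs        = []
      agree (inj₁ v ∷ vs) eqs        = refl ∷ agree vs eqs
      agree (inj₂ j ∷ vs) (eq ∷ eqs) = eq ∷ agree vs eqs

    sat-definable : (φ : Formula ℒ (V ⊎ J)) (f : V → W) (g : J → W) →
                    Definable (λ ρ → M ⊨ φ [ [ ρ ∘ f , ρ ∘ g ] ])
    sat-definable φ f g = resp
      (λ ρ → subst (λ τ → (M ⊨ φ [ ρ ∘ [ f , g ] ]) ⇔ (M ⊨ φ [ τ ]))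
                   (ext λ { (inj₁ x) → refl ; (inj₂ y) → refl }) ⇔.refl)
      (pullback [ f , g ] (⊨-definable φ))

    Named : Pred U ℓ
    Named u = ∃[ c ] ⟦ M ⟧ᶠ {zero} c [] ≡ u

    -- No constants are substituted: `P` is asserted of all `x` that agree with `u` on the finite
    -- support, and `P` cannot tell such an `x` from `u`. Agreement is a formula because the
    -- coordinates of `u` are named.
    instantiate : (P : (V → U) → (J → U) → Set p) →
                  Definable (λ τ → P (τ ∘ inj₁) (τ ∘ inj₂)) →
                  ∀ u → (∀ j → Named (u j)) → Definable (λ ρ → P ρ u)
    instantiate P d u named with finiteSupport P d
    ... | js , support = resp
      (λ ρ → mk⇔ (λ h → h u (All.universal (λ _ → refl) js)) (λ h x eqs → support ρ (All.map sym eqs) h))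
      (∀-definable (λ ρ x → All (λ j → x j ≡ u j) js → P ρ x)
        (All-definable (All.universal (λ j → equals (inj₂ j) (named j)) js) →-definable d))
      where
      equals : ∀ {V : Set v} (x : V) {u} → Named u → Definable (λ ρ → ρ x ≡ u)
      equals x (c , refl) = (var x ≐ app c []) by λ ρ → ⇔.refl

    -- Only finitely many coordinates of u matter for P.
    finiteParameters : (P : (V → U) → (J → U) → Set p) →
                       Definable (λ τ → P (τ ∘ inj₁) (τ ∘ inj₂)) → ∀ u →
                       ∃[ k ] Σ[ js ∈ (Fin k → J) ] Σ[ φ ∈ Formula ℒ (V ⊎ Fin k) ]
                         (∀ ρ → (M ⊨ φ [ [ ρ , u ∘ js ] ]) ⇔ P ρ u)
    finiteParameters {V = V} {J = J} {p = p} P d u with finiteSupport P d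
    ... | js , support =
      L.length js , L.lookup js , formula Q-definable , λ ρ → ⇔.trans (defines Q-definable _)
        (mk⇔ (λ h → h u (λ i → refl))
             (λ h x eqs → support ρ (All.map sym (agree x eqs)) h))
      where
      Q : (V → U) → (Fin (L.length js) → U) → Set _
      Q ρ y = ∀ x → (∀ i → x (L.lookup js i) ≡ y i) → P ρ x
      Q-definable : Definable (λ τ → Q (τ ∘ inj₁) (τ ∘ inj₂))
      Q-definable = ∀-definable _
        (∀Fin-definable (λ i → (var (inj₂ (L.lookup js i)) ≐ var (inj₁ (inj₂ i))) by λ ρ → ⇔.refl)
          →-definable pullback [ inj₁ ∘ inj₁ , inj₂ ] d)
      agree : ∀ x → (∀ i → x (L.lookup js i) ≡ u (L.lookup js i)) → All (λ j → x j ≡ u j) js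
      agree x eqs = All.tabulate λ i → subst (λ j → x j ≡ u j) (sym (lookup-index i)) (eqs (index i))

    -- The injectivity demanded by `FiniteVCDimension` comes for free: the parameter that cuts out
    -- the singleton of `i` separates point `i` from all others.
    shatteringBound : NIP M → ∀ {m n} → Fin m ↔ J → (P : (J → U) → (Fin n → U) → Set p) →
      Definable (λ τ → P (τ ∘ inj₁) (τ ∘ inj₂)) →
      ∃[ d ] ∀ k (pts : Fin k → J → U) →
        (∀ s → ∃[ y ] ∀ i → (i ∈ˢ s) ⇔ P (pts i) y) → k ≤ d
    shatteringBound {J = J} nip {m} {n} m↔J P d = proj₁ bound , λ k pts shatters →
      proj₂ bound k (λ i → tabulate (pts i ∘ Inverse.to m↔J))
        (injective pts shatters) (shatters′ pts shatters)
      where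
      φ : Formula ℒ (Fin m ⊎ Fin n)
      φ = formula (pullback [ inj₁ ∘ Inverse.from m↔J , inj₂ ] d)
      bound = nip φ
      holds : ∀ x y → (M ⊨ φ ⟨ lookup (tabulate (x ∘ Inverse.to m↔J)) , tabulate y ⟩) ⇔ P x y
      holds x y = ⇔.trans (defines (pullback [ inj₁ ∘ Inverse.from m↔J , inj₂ ] d) _)
        (subst (λ z → P z (lookup (tabulate y)) ⇔ P x y)
          (ext λ j → sym (trans (lookup∘tabulate _ (Inverse.from m↔J j)) (cong x (Inverse.strictlyInverseˡ m↔J j))))
          (subst (λ z → P x z ⇔ P x y) (ext λ i → sym (lookup∘tabulate y i)) ⇔.refl))
      shatters′ : ∀ {k} (pts : Fin k → J → U) →
        (∀ s → ∃[ y ] ∀ i → (i ∈ˢ s) ⇔ P (pts i) y) →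
        Shatters (λ b a → M ⊨ φ ⟨ lookup a , b ⟩) (λ i → tabulate (pts i ∘ Inverse.to m↔J))
      shatters′ pts shatters s with shatters s
      ... | y , iff = tabulate y , λ i → ⇔.trans (iff i) (⇔.sym (holds (pts i) y))
      injective : ∀ {k} (pts : Fin k → J → U) → _ → ∀ {i j} →
        tabulate (pts i ∘ Inverse.to m↔J) ≡ tabulate (pts j ∘ Inverse.to m↔J) → i ≡ j
      injective pts shatters {i} {j} eq with shatters′ pts shatters ⁅ i ⁆
      ... | y , iff = sym (x∈⁅y⁆⇒x≡y i (from (iff j)
        (subst (λ z → M ⊨ φ ⟨ lookup z , y ⟩) eq (to (iff i) (x∈⁅x⁆ i)))))

  -- NIP and compressibility in the expansion by constants

  module _ {ℒ : Language ℓ} (𝒰 : Structure ℒ) (B : Pred (Carrier 𝒰) ℓ) where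
    open Definability 𝒰

    -- The constants first become variables, possibly infinitely many. Only finitely many of these
    -- occur, and their values are appended to the tuple `b`.
    constantsAsParameters : (φ : Formula (ℒ ⊕ ∃ B) (V ⊎ Fin n)) →
      ∃[ k ] Σ[ us ∈ Vec (Carrier 𝒰) k ] Allᵛ.All B us ×
      Σ[ χ ∈ Formula ℒ (V ⊎ Fin (n + k)) ]
        (∀ x b → (𝒰 ⊨ χ ⟨ x , b Vec.++ us ⟩) ⇔ (𝒰 ⟪ B ⟫ ⊨ φ ⟨ x , b ⟩))
    constantsAsParameters {V = V} {n = n} φ
      with finiteParameters (λ ρ u → 𝒰 ⊨ abstractConsts φ [ [ ρ , u ] ])
                            (sat-definable (abstractConsts φ) inj₁ inj₂) proj₁
    ... | k , cs , χ , iff = k , us , Allᵛₚ.tabulate⁺ (proj₂ ∘ cs) ,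
      rename f χ , λ x b → subst (_⇔ _) (sym (trans (⊨-rename 𝒰 f χ _) (cong (𝒰 ⊨ χ [_]) (env x b))))
        (subst ((𝒰 ⊨ χ [ _ ]) ⇔_) (⊨-abstract 𝒰 B φ) (iff [ x , lookup b ]))
      where
      us = tabulate (proj₁ ∘ cs)
      f : (V ⊎ Fin n) ⊎ Fin k → V ⊎ Fin (n + k)
      f (inj₁ (inj₁ x)) = inj₁ x
      f (inj₁ (inj₂ i)) = inj₂ (i ↑ˡ k)
      f (inj₂ i)        = inj₂ (n ↑ʳ i)
      env : ∀ x b → [ x , lookup (b Vec.++ us) ] ∘ f ≡ [ [ x , lookup b ] , proj₁ ∘ cs ]
      env x b = ext λ
        { (inj₁ (inj₁ x)) → refl
        ; (inj₁ (inj₂ i)) → lookup-++ˡ b us i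
        ; (inj₂ i)        → trans (lookup-++ʳ b us i) (lookup∘tabulate _ i) }

    -- Fixing the parameters `us` yields a subfamily of the one defined by `χ`, so the same bound
    -- serves.
    NIP-expansion : NIP 𝒰 → NIP (𝒰 ⟪ B ⟫)
    NIP-expansion nip φ =
      let (k , us , us∈B , χ , iff) = constantsAsParameters φ
          (d , bound) = nip χ
      in d , λ k pts injective shatters → bound k pts injective λ s →
        let (b , s⇔φ) = shatters s
        in b Vec.++ us , λ i → ⇔.trans (s⇔φ i) (⇔.sym (iff _ b))

    Compressible-expansion : {I : Set v} {a : I → Carrier 𝒰} →
                             Compressible 𝒰 a B → Compressible (𝒰 ⟪ B ⟫) a B
    Compressible-expansion {a = a} compressible φ =
      let (k , us , us∈B , χ , iff) = constantsAsParameters φ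
          (m , ψ , compress) = compressible χ
      in m , embed ψ , λ B₀ B₀⊆B →
        let (c , c∈B , ψac , entails) =
              -- The parameters of `χ` join `B₀`, because the tuples to be decided are
              -- `b Vec.++ us`.
              compress (B₀ ++ Vec.toList us) (All.++⁺ B₀⊆B (Allᵛₚ.toList⁺ us∈B))
        in c , c∈B , subst id (sym (⊨-embed 𝒰 B ψ)) ψac , λ a′ ψa′c b b∈B₀ →
          let (pos , neg) = entails a′ (subst id (⊨-embed 𝒰 B ψ) ψa′c) (b Vec.++ us)
                              (Allᵛₚ.++⁺ (Allᵛ.map ∈-++⁺ˡ b∈B₀) (listed us))
          in (λ φab → to (iff a′ b) (pos (from (iff a b) φab))) ,
             (λ ¬φab φa′b → neg (λ χab → ¬φab (to (iff a b) χab)) (from (iff a′ b) φa′b))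
      where
      listed : ∀ {B₀ k} (us : Vec (Carrier 𝒰) k) → Allᵛ.All (_∈ˡ B₀ ++ Vec.toList us) us
      listed {B₀} us = subst (Allᵛ.All _) (tabulate∘lookup us)
        (Allᵛₚ.tabulate⁺ λ i → ∈-++⁺ʳ B₀ (∈-toList⁺ (∈-lookup i us)))

  -- Passing from a named set to a subset

  module Core {ℒ : Language ℓ} (M : Structure ℒ) (nip : NIP M)
    (A B : Pred (Carrier M) ℓ) (A⊆B : A ⊆ B) (named : B ⊆ Definability.Named M)
    {I : Set ℓ} (a : I → Carrier M) (compressible : Compressible M a B) where

    open Definability M

    private
      U = Carrier M
      variable m k N s : ℕ

    Tuple : ℕ → Set ℓ
    Tuple n = Fin n → U

    Holds : Formula ℒ (I ⊎ Fin n) → (I → U) → Tuple n → Set ℓ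
    Holds φ x b = M ⊨ φ [ [ x , b ] ]

    Within : Pred U ℓ → {J : Set} → (J → U) → Set ℓ
    Within C b = ∀ j → C (b j)

    Entails : Formula ℒ (I ⊎ Fin m) → Tuple m → Formula ℒ (I ⊎ Fin n) → Tuple n → Set ℓ
    Entails ψ d φ b = ∀ x → Holds ψ x d → Holds φ x b

    Entails-definable : {V : Set v} (ψ : Formula ℒ (I ⊎ Fin m)) (d : Fin m → V)
                        (φ : Formula ℒ (I ⊎ Fin n)) (b : Fin n → V) →
                        Definable (λ ρ → Entails ψ (ρ ∘ d) φ (ρ ∘ b))
    Entails-definable ψ d φ b = ∀-definable _
      (sat-definable ψ inj₂ (inj₁ ∘ d) →-definable sat-definable φ inj₂ (inj₁ ∘ b))

    -- Only positive instances are considered; negative ones are recovered at the end from `¬′ φ`.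
    Compressor : Formula ℒ (I ⊎ Fin m) → Formula ℒ (I ⊎ Fin n) → Set ℓ
    Compressor ψ φ = ∀ L → All (Within B) L → All (Holds φ a) L →
      ∃[ d ] Within B d × Holds ψ a d × All (Entails ψ d φ) L

    compressor : (φ : Formula ℒ (I ⊎ Fin n)) →
                 ∃[ m ] Σ[ ψ ∈ Formula ℒ (I ⊎ Fin m) ] Compressor ψ φ
    compressor φ =
      let (m , ψ , compress) = compressible φ
      in m , ψ , λ L L⊆B L⊆φ →
        let (c , c∈B , ψac , entails) = compress (concatMap L.tabulate L) (entries⊆B L⊆B)
        in lookup c , (λ i → Allᵛ.lookup c∈B (∈-lookup i c)) , ψac , All.tabulate λ {b} b∈L x ψxc →
          let listed = Allᵛₚ.tabulate⁺ λ i →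
                         ∈-concatMap⁺ L.tabulate (lose b∈L (∈-tabulate⁺ i))
          in subst (Holds φ x) (ext (lookup∘tabulate b)) (proj₁ (entails x ψxc (tabulate b) listed)
               (subst (Holds φ a) (ext (sym ∘ lookup∘tabulate b)) (All.lookup L⊆φ b∈L)))
      where
      entries⊆B : ∀ {n} {L : List (Tuple n)} → All (Within B) L → All B (concatMap L.tabulate L)
      entries⊆B []        = []
      entries⊆B (b∈B ∷ bs) = All.++⁺ (All.tabulate⁺ b∈B) (entries⊆B bs)

    PositivelyCompressible : Formula ℒ (I ⊎ Fin n) → Set ℓ
    PositivelyCompressible {n} φ = ∃[ m ] Σ[ ψ ∈ Formula ℒ (I ⊎ Fin m) ] (∀ A₀ → All A A₀ →
      ∃[ c ] Within A c × Holds ψ a c ×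
        (∀ b → (∀ i → b i ∈ˡ A₀) → Holds φ a b → Entails ψ c φ b))

    Positive : Formula ℒ (I ⊎ Fin n) → List (Tuple n) → Set ℓ
    Positive φ L = All (Within A) L × All (Holds φ a) L

    -- R stands for the information about a over A that is to be preserved; the
    -- list L depends on R but not on its parameters c.
    Undecided : Formula ℒ (I ⊎ Fin n) → Set (lsuc ℓ)
    Undecided {n} φ = ∀ {J : Set} {s} → Fin s ↔ J → (R : (I → U) → (J → U) → Set ℓ) →
      Definable (λ τ → R (τ ∘ inj₁) (τ ∘ inj₂)) →
      ∃[ L ] Positive φ L ×
        (∀ c → Within A c → R a c → ∃[ b ] b ∈ˡ L × (∃[ x ] R x c × ¬ Holds φ x b))

    tuples : ∀ n → List U → List (Tuple n)
    tuples zero    xs = (λ ()) ∷ []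
    tuples (suc n) xs = cartesianProductWith _∷ᶠ_ xs (tuples n xs)

    ∈-tuples⁺ : ∀ {xs} (b : Tuple n) → (∀ i → b i ∈ˡ xs) → b ∈ˡ tuples n xs
    ∈-tuples⁺ {n = zero}  b b∈xs = here (ext λ ())
    ∈-tuples⁺ {n = suc n} b b∈xs = subst (_∈ˡ _) (ext λ { zero → refl ; (suc i) → refl })
      (∈-cartesianProductWith⁺ _∷ᶠ_ (b∈xs zero) (∈-tuples⁺ (b ∘ suc) (b∈xs ∘ suc)))

    tuples-All : ∀ n {xs} → All A xs → All (Within A) (tuples n xs)
    tuples-All zero    xs⊆A = (λ ()) ∷ []
    tuples-All (suc n) xs⊆A = All.cartesianProductWith⁺ (≡-setoid U) (≡-setoid (Tuple n)) _∷ᶠ_ _ _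
      λ x∈xs f∈fs → λ
        { zero → All.lookup xs⊆A x∈xs ; (suc i) → All.lookup (tuples-All n xs⊆A) f∈fs i }

    -- If every `L` failed for `R`, then `R` itself would compress `φ` positively over `A`: given
    -- `A₀`, let `L` consist of the tuples `b` from `A₀` with `φ(a,b)`. A parameter `c` at which `L`
    -- fails satisfies `R a c`, and `R(x,c)` implies `φ(x,b)` for all `b` in `L`.
    undecided : (φ : Formula ℒ (I ⊎ Fin n)) → ¬ PositivelyCompressible φ → Undecided φ
    undecided {n} φ ¬compressed {J} {s} s↔J R d = byContradiction λ none →
      ¬compressed (s , formula ψ , λ A₀ A₀⊆A → byContradiction λ ¬c → none
        ( filter Holds? (tuples n A₀)
        , (All.filter⁺ Holds? (tuples-All n A₀⊆A) , All.all-filter Holds? (tuples n A₀))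
        , λ c c∈A Rac → byContradiction λ ¬b → ¬c
            ( c ∘ to↔ , (c∈A ∘ to↔) , from (defines ψ _) (subst (R a) (sym (c≡ c)) Rac)
            , λ b b∈A₀ φab x ψxc → byContradiction λ ¬φxb → ¬b
                ( b , ∈-filter⁺ Holds? (∈-tuples⁺ b b∈A₀) φab
                , x , subst (R x) (c≡ c) (to (defines ψ _) ψxc) , ¬φxb)) ))
      where
      to↔ = Inverse.to s↔J
      Holds? : ∀ b → Dec (Holds φ a b)
      Holds? b = em
      ψ : Definable _
      ψ = pullback [ inj₁ , inj₂ ∘ Inverse.from s↔J ] d
      c≡ : (c : J → U) → c ∘ to↔ ∘ Inverse.from s↔J ≡ c
      c≡ c = ext λ j → cong c (Inverse.strictlyInverseˡ s↔J j)

    -- Families shattered by witnesses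

    module _ {n} (φ : Formula ℒ (I ⊎ Fin n)) (undecidedφ : Undecided φ)
             {m₀} (ψ₀ : Formula ℒ (I ⊎ Fin m₀)) where

      Selects : Subset N → (Fin N → Tuple n) → Tuple m₀ → Set ℓ
      Selects s e w = ∀ i → (i ∈ˢ s) ⇔ Entails ψ₀ w φ (e i)

      Covers : List (Tuple n) → Tuple m₀ → Set ℓ
      Covers L w = All (Entails ψ₀ w φ) L

      -- The witnesses `w` range over all of `M`, which makes this a first-order condition on `D`
      -- and `e`.
      Shattered : Formula ℒ (I ⊎ Fin m) → Tuple m → List (Tuple n) → (Fin N → Tuple n) → Set ℓ
      Shattered ψ D L e = ∀ s → ∃[ w ] Entails ψ D ψ₀ w × Covers L w × Selects s e w

      -- Freely: the witnesses can be made to decide any finite L in advance.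
      ShattersFreely : Formula ℒ (I ⊎ Fin m) → ℕ → Set ℓ
      ShattersFreely ψ N = ∀ L → Positive φ L →
        Σ[ e ∈ (Fin N → Tuple n) ] (∀ i → Within A (e i)) ×
        ∃[ D ] Within B D × Holds ψ a D × Shattered ψ D L e

      Covers-definable : {V : Set v} {L : List (Tuple n)} → All (Within A) L →
                         (w : Fin m₀ → V) → Definable (λ ρ → Covers L (ρ ∘ w))
      Covers-definable L⊆A w = All-definable (All.map
        (λ {b} b∈A → instantiate (λ ρ b → Entails ψ₀ (ρ ∘ w) φ b)
          (Entails-definable ψ₀ (inj₁ ∘ w) φ inj₂) b (named ∘ A⊆B ∘ b∈A)) L⊆A)

      Selects-definable : {V : Set v} (s : Subset N) (e : Fin N → Fin n → V) (w : Fin m₀ → V) →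
                          Definable (λ ρ → Selects s (λ i j → ρ (e i j)) (ρ ∘ w))
      Selects-definable s e w = ∀Fin-definable λ i →
        ⇔-definable (fixed-definable _) (Entails-definable ψ₀ w φ (e i))

      Shattered-definable : {V : Set v} (ψ : Formula ℒ (I ⊎ Fin m)) (D : Fin m → V) →
        {L : List (Tuple n)} → All (Within A) L → (e : Fin N → Fin n → V) →
        Definable (λ ρ → Shattered ψ (ρ ∘ D) L (λ i j → ρ (e i j)))
      Shattered-definable ψ D L⊆A e = ∀Subset-definable λ s → ∃-definable _
        (Entails-definable ψ (inj₁ ∘ D) ψ₀ inj₂ ×-definable Covers-definable L⊆A inj₂
          ×-definable Selects-definable s (λ i j → inj₁ (e i j)) inj₂)

      -- From families of size N to size N + 1

      module Extension {N m m′} (ψ : Formula ℒ (I ⊎ Fin m)) (ψ′ : Formula ℒ (I ⊎ Fin m′))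
        (compress : Compressor ψ′ ψ) (shatters : ShattersFreely ψ N)
        (L₀ : List (Tuple n)) (L₀⁺ : Positive φ L₀)
        (stuck : ¬ (Σ[ e ∈ (Fin (suc N) → Tuple n) ] (∀ i → Within A (e i)) ×
                    ∃[ D ] Within B D × Holds ψ′ a D × Shattered ψ′ D L₀ e)) where

        -- A block consists of b, at index zero, and of the family e.
        Block : Set ℓ
        Block = Fin (suc N) → Tuple n

        -- The half of shattering `β` that concerns subsets without index zero. The other half is
        -- available once the witnesses for `e` can be made to decide `b`.
        Flips : Tuple m′ → Block → Set ℓ
        Flips D β = ∀ s → ∃[ w ] Entails ψ′ D ψ₀ w × Covers L₀ w × Selects s (β ∘ suc) w ×
                                 ¬ Entails ψ₀ w φ (β zero)

        Flips-definable : {V : Set v} (D : Fin m′ → V) (β : Fin (suc N) → Fin n → V) →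
                          Definable (λ ρ → Flips (ρ ∘ D) (λ i j → ρ (β i j)))
        Flips-definable D β = ∀Subset-definable λ s → ∃-definable _
          (Entails-definable ψ′ (inj₁ ∘ D) ψ₀ inj₂ ×-definable
           Covers-definable (proj₁ L₀⁺) inj₂ ×-definable
           Selects-definable s (λ i j → inj₁ (β (suc i) j)) inj₂ ×-definable
           ¬-definable (Entails-definable ψ₀ inj₂ φ (inj₁ ∘ β zero)))

        Move : (Fin N → Tuple n) → (I → U) → (Tuple m → Set ℓ) → Set ℓ
        Move e x T = ∃[ D ] Holds ψ x D × Shattered ψ D L₀ e × T D

        Move-definable : {V : Set ℓ} (e : Fin N → Fin n → V) (x : I → V)
          (T : (V → U) → Tuple m → Set ℓ) → Definable (λ τ → T (τ ∘ inj₁) (τ ∘ inj₂)) →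
          Definable (λ ρ → Move (λ i j → ρ (e i j)) (ρ ∘ x) (T ρ))
        Move-definable e x T d = ∃-definable _
          (sat-definable ψ (inj₁ ∘ x) inj₂ ×-definable
           Shattered-definable ψ inj₂ (proj₁ L₀⁺) (λ i j → inj₁ (e i j)) ×-definable d)

        -- All 2ᵏ ways to move or not to move at each block, as one first-order
        -- condition on x.  The predicate Q collects what is required of the D′ at
        -- the leaves.  The clause for moving does not depend on x, but the
        -- condition on the remaining blocks, which x′ inherits from x, does.
        Tree : ∀ k → (Fin k → Block) → (I → U) → (Tuple m′ → Set ℓ) → Set ℓ
        Tree zero    r x Q = ∃[ D ] Q D
        Tree (suc k) r x Q =
          Move (r zero ∘ suc) x (λ D → Tree k (r ∘ suc) x
            (λ D′ → Q D′ × Entails ψ′ D′ ψ D × ¬ Flips D′ (r zero))) ×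
          (∃[ x′ ] ¬ Holds φ x′ (r zero zero) ×
            Move (r zero ∘ suc) x′ (λ D → Tree k (r ∘ suc) x′
              (λ D′ → Q D′ × Entails ψ′ D′ ψ D)))

        Tree-mono : ∀ k {r x} {Q Q′ : Tuple m′ → Set ℓ} → (∀ {D} → Q D → Q′ D) →
                    Tree k r x Q → Tree k r x Q′
        Tree-mono zero    f (D , q) = D , f q
        Tree-mono (suc k) f ((D , ψxD , sh , t) , x′ , ¬φ , D₁ , ψx′D₁ , sh₁ , t₁) =
          (D , ψxD , sh , Tree-mono k (λ (q , rest) → f q , rest) t) ,
          x′ , ¬φ , D₁ , ψx′D₁ , sh₁ , Tree-mono k (λ (q , rest) → f q , rest) t₁

        -- The subset `s` names a path: `inside` moves, `outside` stays. After a move, `x′`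
        -- satisfies `ψ(x,D)`, hence `ψ₀(x,w)` for every `w` below `D`, but not `φ(x,b)`. So no such
        -- `w` decides `b`, and the witnesses that shatter `e` are those that `Flips` asks for.
        Tree-shatters : ∀ k {r x} {Q : Tuple m′ → Set ℓ} → Tree k r x Q → ∀ s →
                        ∃[ D ] Q D × (∀ i → (i ∈ˢ s) ⇔ Flips D (r i))
        Tree-shatters zero    (D , q) []            = D , q , λ ()
        Tree-shatters (suc k) ((D , _ , _ , t) , _) (outside ∷ s) with Tree-shatters k t s
        ... | D′ , (q , _ , ¬flips) , iff = D′ , q , λ
          { zero    → mk⇔ (λ ()) (λ flips → contradiction flips ¬flips)
          ; (suc i) → ⇔.trans suc∈⇔ (iff i) }
        Tree-shatters (suc k) (_ , x′ , ¬φ , D , ψx′D , sh , t) (inside ∷ s) with Tree-shatters k t s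
        ... | D′ , (q , D′⊢D) , iff = D′ , q , λ
          { zero    → mk⇔ (λ _ s′ →
              let (w , D⊢w , cov , sel) = sh s′
              in w , (λ x → D⊢w x ∘ D′⊢D x) , cov , sel , λ w⊢b → ¬φ (w⊢b x′ (D⊢w x′ ψx′D)))
              (λ _ → here)
          ; (suc i) → ⇔.trans suc∈⇔ (iff i) }

        Tree-definable : ∀ k {V : Set ℓ} (r : Fin k → Fin (suc N) → Fin n → V) (x : I → V)
          (Q : (V → U) → Tuple m′ → Set ℓ) → Definable (λ τ → Q (τ ∘ inj₁) (τ ∘ inj₂)) →
          Definable (λ ρ → Tree k (λ i j l → ρ (r i j l)) (ρ ∘ x) (Q ρ))
        Tree-definable zero    r x Q d = ∃-definable Q d
        Tree-definable (suc k) r x Q d =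
          Move-definable (r zero ∘ suc) x _
            (Tree-definable k (λ i j l → inj₁ (r (suc i) j l)) (inj₁ ∘ x) _
              (pullback [ inj₁ ∘ inj₁ , inj₂ ] d ×-definable
               Entails-definable ψ′ inj₂ ψ (inj₁ ∘ inj₂) ×-definable
               ¬-definable (Flips-definable inj₂ (λ i j → inj₁ (inj₁ (r zero i j)))))) ×-definable
          ∃-definable _
            (¬-definable (sat-definable φ inj₂ (inj₁ ∘ r zero zero)) ×-definable
             Move-definable (λ i j → inj₁ (r zero (suc i) j)) inj₂ _
               (Tree-definable k (λ i j l → inj₁ (inj₁ (r (suc i) j l))) (inj₁ ∘ inj₂) _
                 (pullback [ inj₁ ∘ inj₁ ∘ inj₁ , inj₂ ] d ×-definable
                  Entails-definable ψ′ inj₂ ψ (inj₁ ∘ inj₂))))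

        -- Q holds for all D′ from B that lie above certain finitely many D from B.
        Forced : (Tuple m′ → Set ℓ) → Set ℓ
        Forced Q = ∃[ Ds ] All (Within B) Ds × All (Holds ψ a) Ds ×
          (∀ D → Within B D → Holds ψ′ a D → All (Entails ψ′ D ψ) Ds → Q D)

        -- Subsets without `b` would get witnesses from `flips`, those with `b` get them from `sh`,
        -- where `b` is prescribed; the latter lie below `D`, hence below `D′`. Together they would
        -- shatter `b ∷ᶠ e`, against `stuck`.
        ¬flips : ∀ {b e D D′} → Within A b → (∀ i → Within A (e i)) →
                 Shattered ψ D (L₀ ++ b ∷ []) e →
                 Within B D′ → Holds ψ′ a D′ → Entails ψ′ D′ ψ D → ¬ Flips D′ (b ∷ᶠ e)
        ¬flips {b} {e} {D} {D′} b∈A e∈A sh D′∈B ψ′aD′ D′⊢D flips =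
          stuck (b ∷ᶠ e , be∈A , D′ , D′∈B , ψ′aD′ , shattered)
          where
          be∈A : ∀ i → Within A ((b ∷ᶠ e) i)
          be∈A zero    = b∈A
          be∈A (suc i) = e∈A i
          shattered : Shattered ψ′ D′ L₀ (b ∷ᶠ e)
          shattered (inside ∷ s) with sh s
          ... | w , D⊢w , cov , sel = w , (λ x → D⊢w x ∘ D′⊢D x) , All.++⁻ˡ L₀ cov , sel′
            where
            sel′ : Selects (inside ∷ s) (b ∷ᶠ e) w
            sel′ zero    = mk⇔ (λ _ → All.head (All.++⁻ʳ L₀ cov)) (λ _ → here)
            sel′ (suc i) = ⇔.trans suc∈⇔ (sel i)
          shattered (outside ∷ s) with flips s
          ... | w , D′⊢w , cov , sel , ¬w⊢b = w , D′⊢w , cov , sel′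
            where
            sel′ : Selects (outside ∷ s) (b ∷ᶠ e) w
            sel′ zero    = mk⇔ (λ ()) (λ w⊢b → contradiction w⊢b ¬w⊢b)
            sel′ (suc i) = ⇔.trans suc∈⇔ (sel i)

        -- Construction of the blocks

        Built : ℕ → (Tuple m′ → Set ℓ) → Set ℓ
        Built k Q = Σ[ r ∈ (Fin k → Block) ] (∀ i j → Within A (r i j)) × Tree k r a Q

        Index : ℕ → Set
        Index k = (Fin N × Fin n) ⊎ (Fin k × Fin (suc N) × Fin n)

        Index-finite : ∀ k → Fin _ ↔ Index k
        Index-finite k = (*↔× ⊎-↔ ((↔-refl ×-↔ *↔×) ↔-∘ *↔×)) ↔-∘ +↔⊎

        -- The clause for moving, minus the condition on `b`. It is the `R` given to `undecidedφ`;
        -- as `e` and the later blocks are its parameters `c`, the list `L` can be found before they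
        -- are.
        Continues : ∀ k → (Tuple m′ → Set ℓ) → (I → U) → (Index k → U) → Set ℓ
        Continues k Q x c = Move (λ i j → c (inj₁ (i , j))) x λ D →
          Tree k (λ i j l → c (inj₂ (i , j , l))) x λ D′ → Q D′ × Entails ψ′ D′ ψ D

        Continues-definable : ∀ k {Q} → Definable Q →
                              Definable (λ τ → Continues k Q (τ ∘ inj₁) (τ ∘ inj₂))
        Continues-definable k d = Move-definable _ inj₁ _
          (Tree-definable k _ (inj₁ ∘ inj₁) _
            (pullback inj₂ d ×-definable Entails-definable ψ′ inj₂ ψ (inj₁ ∘ inj₂)))

        -- The b of the block is only selected from L after all later blocks have
        -- been built, so these have to be prepared for every b in L.
        Next : (Tuple m′ → Set ℓ) → List (Tuple n) → (Fin N → Tuple n) → Tuple m → Tuple m′ → Set ℓ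
        Next Q L e D D′ = Q D′ × Entails ψ′ D′ ψ D × All (λ b → ¬ Flips D′ (b ∷ᶠ e)) L

        -- Later stages apply `undecidedφ` to a condition built from this one, so it must be a
        -- formula in `D′`. The fixed tuples in it come from `B` and are named by constants.
        Next-definable : ∀ {Q L e D} → Definable Q → All (Within A) L → (∀ i → Within A (e i)) →
                         Within B D → Definable (Next Q L e D)
        Next-definable {e = e} {D = D} d L⊆A e∈A D∈B = d ×-definable
          instantiate (λ ρ D → Entails ψ′ ρ ψ D) (Entails-definable ψ′ inj₁ ψ inj₂) D
            (named ∘ D∈B) ×-definable
          All-definable (All.map (λ {b} b∈A →
            instantiate (λ ρ β → ¬ Flips ρ (λ i j → β (i , j)))
              (¬-definable (Flips-definable inj₁ (λ i j → inj₂ (i , j))))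
              (uncurry (b ∷ᶠ e))
              (λ { (zero , j) → named (A⊆B (b∈A j)) ; (suc i , j) → named (A⊆B (e∈A i j)) }))
            L⊆A)

        -- `D` joins the tuples that `D′` has to lie above. As `e` has witnesses that decide all of
        -- `L`, `¬flips` applies to every `b` in `L`, whichever is selected afterwards.
        Next-forced : ∀ {Q L e D} → Forced Q → All (Within A) L → (∀ i → Within A (e i)) →
                      Within B D → Holds ψ a D → Shattered ψ D (L₀ ++ L) e → Forced (Next Q L e D)
        Next-forced (Ds , Ds⊆B , ψaDs , forced) L⊆A e∈A D∈B ψaD sh =
          _ ∷ Ds , D∈B ∷ Ds⊆B , ψaD ∷ ψaDs , λ { D′ D′∈B ψ′aD′ (D′⊢D ∷ D′⊢Ds) →
            forced D′ D′∈B ψ′aD′ D′⊢Ds , D′⊢D , All.tabulate λ b∈L →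
              ¬flips (All.lookup L⊆A b∈L) e∈A (restrict b∈L) D′∈B ψ′aD′ D′⊢D }
          where
          restrict : ∀ {b} → b ∈ˡ _ → Shattered ψ _ (L₀ ++ b ∷ []) _
          restrict b∈L s =
            let (w , D⊢w , cov , sel) = sh s
            in w , D⊢w , All.++⁺ (All.++⁻ˡ L₀ cov) (All.lookup (All.++⁻ʳ L₀ cov) b∈L ∷ []) , sel

        -- The tree over `a` is used twice. With `¬ Flips` forgotten, it shows that `a` satisfies
        -- `Continues`, which `wrong` carries over to some `x′` violating `φ` at some `b` in `L`.
        -- For this `b` it also provides the clause for not moving.
        graft : ∀ k {Q L e D} → All (Within A) L → (∀ i → Within A (e i)) →
          Holds ψ a D → Shattered ψ D (L₀ ++ L) e →
          (∀ c → Within A c → Continues k Q a c →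
            ∃[ b ] b ∈ˡ L × (∃[ x ] Continues k Q x c × ¬ Holds φ x b)) →
          Built k (Next Q L e D) → Built (suc k) Q
        graft k {Q} {L} {e} {D} L⊆A e∈A ψaD sh wrong (r , r∈A , tree) = result
          (wrong [ uncurry e , (λ (i , j , l) → r i j l) ]
            (λ { (inj₁ (i , j)) → e∈A i j ; (inj₂ (i , j , l)) → r∈A i j l })
            (D , ψaD , sh₀ , Tree-mono k (λ (q , D′⊢D , _) → q , D′⊢D) tree))
          where
          sh₀ : Shattered ψ D L₀ e
          sh₀ s = let (w , D⊢w , cov , sel) = sh s in w , D⊢w , All.++⁻ˡ L₀ cov , sel
          result : (∃[ b ] b ∈ˡ L ×
                     (∃[ x ] Continues k Q x [ uncurry e , (λ (i , j , l) → r i j l) ] × ¬ Holds φ x b)) →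
                   Built (suc k) Q
          result (b , b∈L , x′ , continues , ¬φx′b) =
            (λ { zero → b ∷ᶠ e ; (suc i) → r i }) ,
            (λ { zero zero → All.lookup L⊆A b∈L ; zero (suc j) → e∈A j ; (suc i) → r∈A i }) ,
            (D , ψaD , sh₀ ,
              Tree-mono k (λ (q , D′⊢D , ¬f) → q , D′⊢D , All.lookup ¬f b∈L) tree) ,
            x′ , ¬φx′b , continues

        build : ∀ k {Q} → Definable Q → Forced Q → Built k Q
        build zero    d (Ds , Ds⊆B , ψaDs , forced) =
          -- All tuples collected in `Ds` satisfy `ψ` together with `a`, so `ψ′` provides a single
          -- leaf above all of them.
          let (D , D∈B , ψ′aD , D⊢Ds) = compress Ds Ds⊆B ψaDs
          in (λ ()) , (λ ()) , D , forced D D∈B ψ′aD D⊢Ds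
        build (suc k) {Q} d forced =
          after (undecidedφ (Index-finite k) (Continues k Q) (Continues-definable k d))
          where
          after : ∃[ L ] Positive φ L × (∀ c → Within A c → Continues k Q a c →
                    ∃[ b ] b ∈ˡ L × (∃[ x ] Continues k Q x c × ¬ Holds φ x b)) →
                  Built (suc k) Q
          after (L , (L⊆A , φaL) , wrong)
            -- Prescribing `L` besides `L₀` makes the witnesses for `e` decide every candidate for
            -- `b`.
            with shatters (L₀ ++ L) (All.++⁺ (proj₁ L₀⁺) L⊆A , All.++⁺ (proj₂ L₀⁺) φaL)
          ... | e , e∈A , D , D∈B , ψaD , sh = graft k L⊆A e∈A ψaD sh wrong
            (build k (Next-definable d L⊆A e∈A D∈B) (Next-forced forced L⊆A e∈A D∈B ψaD sh))

        flipsShatter : ∀ k → Σ[ r ∈ (Fin k → Block) ]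
                       (∀ s → ∃[ D ] ∀ i → (i ∈ˢ s) ⇔ Flips D (r i))
        flipsShatter k =
          let (r , _ , tree) = build k {λ _ → ⊤} (⊤-definable _) ([] , [] , [] , _)
          in r , λ s → let (D , _ , iff) = Tree-shatters k tree s in D , iff

        impossible : ⊥
        impossible = contradict (shatteringBound nip *↔×
          (λ β D → Flips D (curry β)) (Flips-definable inj₂ (curry inj₁)))
          where
          contradict : ∃[ d ] (∀ k (pts : Fin k → Fin (suc N) × Fin n → U) →
            (∀ s → ∃[ D ] ∀ i → (i ∈ˢ s) ⇔ Flips D (curry (pts i))) → k ≤ d) → ⊥
          contradict (d , bound) =
            let (r , shatter) = flipsShatter (suc d)
            in 1+n≰n (bound (suc d) (uncurry ∘ r) shatter)

      -- Iteration on N and contradiction with NIP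

      extend : ∀ {N m m′} (ψ : Formula ℒ (I ⊎ Fin m)) (ψ′ : Formula ℒ (I ⊎ Fin m′)) →
               Compressor ψ′ ψ → ShattersFreely ψ N → ShattersFreely ψ′ (suc N)
      extend ψ ψ′ compress shatters L L⁺ = byContradiction
        (Extension.impossible ψ ψ′ compress shatters L L⁺)

      -- Each step replaces `ψ` by a compressor of `ψ`. The relation "`w` decides `b`" involves only
      -- `ψ₀` and `φ` and stays the same for all `N`.
      shattersFreely : Compressor ψ₀ φ → ∀ N →
        ∃[ m ] Σ[ ψ ∈ Formula ℒ (I ⊎ Fin m) ] ShattersFreely ψ N
      -- For the empty family, `D` serves as its own witness.
      shattersFreely compress zero = m₀ , ψ₀ , λ L (L⊆A , φaL) →
        let (D , D∈B , ψaD , D⊢L) = compress L (All.map (A⊆B ∘_) L⊆A) φaL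
        in (λ ()) , (λ ()) , D , D∈B , ψaD , λ s → D , (λ x ψxD → ψxD) , D⊢L , λ ()
      shattersFreely compress (suc N) = step (shattersFreely compress N)
        where
        step : ∃[ m ] Σ[ ψ ∈ Formula ℒ (I ⊎ Fin m) ] ShattersFreely ψ N →
               ∃[ m ] Σ[ ψ ∈ Formula ℒ (I ⊎ Fin m) ] ShattersFreely ψ (suc N)
        step (m , ψ , shatters) with compressor ψ
        ... | m′ , ψ′ , compress′ = m′ , ψ′ , extend ψ ψ′ compress′ shatters

      selectsShatter : Compressor ψ₀ φ → ∀ N →
                       Σ[ e ∈ (Fin N → Tuple n) ] (∀ s → ∃[ w ] Selects s e w)
      selectsShatter compress N =
        let (_ , _ , shatters) = shattersFreely compress N
            (e , _ , _ , _ , _ , shattered) = shatters [] ([] , [])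
        in e , λ s → let (w , _ , _ , selects) = shattered s in w , selects

      -- A single formula, "`w` decides `b`", would shatter families of every size.
      unbounded : ¬ Compressor ψ₀ φ
      unbounded compress = contradict (shatteringBound nip ↔-refl
        (λ b w → Entails ψ₀ w φ b) (Entails-definable ψ₀ inj₂ φ inj₁))
        where
        contradict : ∃[ d ] (∀ k (pts : Fin k → Tuple n) →
          (∀ s → ∃[ w ] Selects s pts w) → k ≤ d) → ⊥
        contradict (d , bound) =
          let (e , shatter) = selectsShatter compress (suc d)
          in 1+n≰n (bound (suc d) e shatter)

    -- Compressibility over the subset

    positivelyCompressible : (φ : Formula ℒ (I ⊎ Fin n)) → PositivelyCompressible φ
    positivelyCompressible φ = byContradiction λ ¬compressed →
      let (m₀ , ψ₀ , compress) = compressor φ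
      in unbounded φ (undecided φ ¬compressed) ψ₀ compress

    -- `φ` and its negation are compressed separately; the conjunction of the two compressing
    -- formulas handles both signs.
    compressible-subset : Compressible M a A
    compressible-subset φ =
      let (m₁ , ψ₁ , compress₁) = positivelyCompressible φ
          (m₂ , ψ₂ , compress₂) = positivelyCompressible (¬′ φ)
          ψ = sat-definable ψ₁ inj₁ (inj₂ ∘ (_↑ˡ m₂)) ×-definable
              sat-definable ψ₂ inj₁ (inj₂ ∘ (m₁ ↑ʳ_))
      in m₁ + m₂ , formula ψ , λ A₀ A₀⊆A →
        let (c₁ , c₁∈A , ψ₁ac₁ , entails₁) = compress₁ A₀ A₀⊆A
            (c₂ , c₂∈A , ψ₂ac₂ , entails₂) = compress₂ A₀ A₀⊆A
            c = tabulate c₁ Vec.++ tabulate c₂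
            eq₁ : lookup c ∘ (_↑ˡ m₂) ≡ c₁
            eq₁ = ext λ i → trans (lookup-++ˡ (tabulate c₁) (tabulate c₂) i) (lookup∘tabulate c₁ i)
            eq₂ : lookup c ∘ (m₁ ↑ʳ_) ≡ c₂
            eq₂ = ext λ i → trans (lookup-++ʳ (tabulate c₁) (tabulate c₂) i) (lookup∘tabulate c₂ i)
        in c , Allᵛₚ.++⁺ (Allᵛₚ.tabulate⁺ c₁∈A) (Allᵛₚ.tabulate⁺ c₂∈A) ,
           from (defines ψ _) (subst (Holds ψ₁ a) (sym eq₁) ψ₁ac₁ , subst (Holds ψ₂ a) (sym eq₂) ψ₂ac₂) ,
           λ a′ ψa′c b b∈A₀ →
             let (ψ₁a′c , ψ₂a′c) = to (defines ψ _) ψa′c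
                 b∈ = λ i → Allᵛ.lookup b∈A₀ (∈-lookup i b)
             in (λ φab → entails₁ (lookup b) b∈ φab a′ (subst (Holds ψ₁ a′) eq₁ ψ₁a′c)) ,
                (λ ¬φab → entails₂ (lookup b) b∈ ¬φab a′ (subst (Holds ψ₂ a′) eq₂ ψ₂a′c))

proposition6p23 : (∀ {o} → ExcludedMiddle o) →
    (∀ {o p} → Extensionality o p) →
    ∀ {ℓ} {ℒ : Language ℓ} (T : Theory ℒ) (𝒰 : Structure ℒ) →
    Complete T → Monster T 𝒰 → NIP 𝒰 →
    (A B : Pred (Carrier 𝒰) ℓ) → A ⊆ B → SmallSubset A → SmallSubset B →
    {I : Set ℓ} → I ≺ Carrier 𝒰 → (a : I → Carrier 𝒰) →
    Compressible 𝒰 a B →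
    CompressibleUpTo 𝒰 a A B
-- Naming `B` by constants preserves NIP and compressibility over `B`; compressibility up to `B` is
-- then compressibility over `A` in the expansion.
proposition6p23 em ext T 𝒰 _ _ nip A B A⊆B _ _ _ a compressible =
  Core.compressible-subset (𝒰 ⟪ B ⟫) (NIP-expansion 𝒰 B nip) A B A⊆B
    (λ {u} u∈B → const (u , u∈B) , refl) a (Compressible-expansion 𝒰 B compressible)
  where open Classical em ext
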